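{- Let $\pi,\tau\in\mathfrak{S}_m$ be non-overlapping permutations. If $\pi$ and $\tau$ are c-Wilf equivalent, then $\pi$ and $\tau$ are super-strongly c-Wilf equivalent.
   Context: The standardization $\operatorname{st}(w)$ of a word of distinct integers replaces its smallest entry by 1, the next smallest by 2, etc. For $\pi\in\mathfrak{S}_m$ and $\sigma\in\mathfrak{S}_n$, $\operatorname{Em}(\pi,\sigma)=\{i\in[n-m+1]:\operatorname{st}(\sigma_i\cdots\sigma_{i+m-1})=\pi\}$. For a set $S$ of positive integers, $a^\pi_{n,S}$ is the number of $\sigma\in\mathfrak{S}_n$ with $\operatorname{Em}(\pi,\sigma)=S$. $\pi,\tau$ are c-Wilf equivalent if $a^\pi_{n,\emptyset}=a^\tau_{n,\emptyset}$ for all $n$, and super-strongly c-Wilf equivalent if $a^\pi_{n,S}=a^\tau_{n,S}$ for all $n,S$. The overlap set is $\mathcal{O}_\pi=\{i\in[m-1]:\operatorname{st}(\pi_{i+1}\cdots\pi_m)=\operatorname{st}(\pi_1\cdots\pi_{m-i})\}$; $\pi$ is non-overlapping if $\mathcal{O}_\pi=\{m-1\}$. -}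

module Defs where

open import Data.Fin using (Fin; toℕ)
open import Data.Fin.Permutation using (Permutation′; _⟨$⟩ʳ_)
open import Data.List using (List; map; filter; length; tabulate; take; drop)
open import Data.Nat using (ℕ; suc; _+_; _∸_; _≤_; _<?_)
open import Data.Product using (Σ; _×_; proj₁)
open import Function.Bundles using (Inverse; _⇔_)
open import Level using (0ℓ)
open import Relation.Binary.Bundles using (Setoid)
import Relation.Binary.Construct.On as On
open import Relation.Binary.PropositionalEquality using (_≡_; setoid; _→-setoid_)
open import Relation.Unary using (Pred; _⊆_; _≐_; ∅; ｛_｝)

-- One-line notation σ₁ σ₂ … σₙ, with letters in {1, …, n}.
word : ∀ {n} → Permutation′ n → List ℕ
word σ = tabulate (λ i → suc (toℕ (σ ⟨$⟩ʳ i)))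

-- Standardization: in a word of distinct letters, the k-th smallest letter is
-- the one with exactly k - 1 letters below it, and it is replaced by k.
st : List ℕ → List ℕ
st w = map (λ x → suc (length (filter (_<? x) w))) w

-- The factor w_i w_{i+1} ⋯ w_{i+m-1}; positions i are counted from 1.
factor : ℕ → ℕ → List ℕ → List ℕ
factor i m w = take m (drop (i ∸ 1) w)

-- i ∈ [n - m + 1] is written without subtraction, so that the range is empty
-- whenever n < m.
Em : ∀ {m n} → Permutation′ m → Permutation′ n → Pred ℕ 0ℓ
Em {m} {n} π σ i = 1 ≤ i × i + m ≤ n + 1 × st (factor i m (word σ)) ≡ word π

Overlap : ∀ {m} → Permutation′ m → Pred ℕ 0ℓ
Overlap {m} π i =
  1 ≤ i × i ≤ m ∸ 1 × st (drop i (word π)) ≡ st (take (m ∸ i) (word π))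

NonOverlapping : ∀ {m} → Permutation′ m → Set
NonOverlapping {m} π = Overlap π ≐ ｛ m ∸ 1 ｝

-- The set { σ ∈ 𝔖ₙ : Em(π,σ) = S }.  Two elements are equal when the underlying
-- maps σ agree pointwise, so each permutation is counted once.
Exactly : ∀ {m} → Permutation′ m → ℕ → Pred ℕ 0ℓ → Setoid 0ℓ 0ℓ
Exactly π n S =
  On.setoid {B = Σ (Permutation′ n) (λ σ → Em π σ ≐ S)}
            (Fin n →-setoid Fin n)
            (λ x → proj₁ x ⟨$⟩ʳ_)

HasSize : Setoid 0ℓ 0ℓ → ℕ → Set
HasSize A k = Inverse (setoid (Fin k)) A

-- a^π_{n,S} = k.  This is a relation, not a function into ℕ, because for an
-- arbitrary set S the condition Em(π,σ) = S is not decidable.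
CountIs : ∀ {m} → Permutation′ m → ℕ → Pred ℕ 0ℓ → ℕ → Set
CountIs π n S k = HasSize (Exactly π n S) k

-- a^π_{n,S} = a^τ_{n,S}.
SameCount : ∀ {m} → Permutation′ m → Permutation′ m → ℕ → Pred ℕ 0ℓ → Set
SameCount π τ n S = ∀ k → CountIs π n S k ⇔ CountIs τ n S k

CWilfEquivalent : ∀ {m} → Permutation′ m → Permutation′ m → Set
CWilfEquivalent π τ = ∀ n → SameCount π τ n ∅

SuperStronglyCWilfEquivalent : ∀ {m} → Permutation′ m → Permutation′ m → Set₁
SuperStronglyCWilfEquivalent π τ =
  ∀ n (S : Pred ℕ 0ℓ) → S ⊆ (1 ≤_) → SameCount π τ n S

{-# OPTIONS --safe #-}
module Submission where

-- Let b(n,T) count the σ ∈ 𝔖ₙ in which the pattern occurs at every position of T;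
-- these numbers determine all a_{n,S} by inclusion-exclusion.  If σ can be cut
-- between two letters without cutting an occurrence listed in T, then b(n,T) is a
-- sum of products of counts for shorter words, which agree for π and τ by induction
-- on n.  If two positions of T are too close, then b(n,T) = 0, as the pattern
-- overlaps itself in at most one letter.  The only other T is the chain
-- {1, m, 2m - 1, …} that covers all of [n].  It is unique for given n, so its count
-- is forced by a_{n,∅}.  Inclusion-exclusion is done one position at a time: counts
-- with a required set A and a forbidden set B satisfy
-- c(A, B ∪ {x}) + c(A ∪ {x}, B) = c(A, B).

open import Defs
open import Algebra.Properties.CommutativeSemigroup using (interchange)
open import Data.Empty using (⊥)
open import Data.Fin as Fin using (Fin; toℕ; punchIn)
import Data.Fin.Properties as Fin
open import Data.Fin.Permutation as Perm
  using (Permutation′; _⟨$⟩ʳ_; insert; remove; insert-punchIn; punchIn-permute; ↔⇒≡)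
open import Data.List
  using (List; []; _∷_; _++_; map; length; filter; take; drop; head; lookup; zip; tabulate; upTo)
open import Data.List.Properties using
  ( ≡-dec; ∷-injectiveʳ; map-++; map-∘; tabulate-cong; length-map; length-tabulate; length-take; length-drop
  ; take-take; take-drop; drop-drop; filter-accept; filter-reject )
open import Data.List.Membership.Propositional using (_∈_; find; lose)
open import Data.List.Membership.Propositional.Properties using
  (∈-++⁺ˡ; ∈-++⁺ʳ; ∈-++⁻; ∈-map⁺; ∈-map⁻; ∈-filter⁺; ∈-filter⁻; ∈-upTo⁺; ∈-lookup)
open import Data.List.Relation.Binary.Pointwise as Pointwise using (Pointwise; []; _∷_; ≡⇒Pointwise-≡)
open import Data.List.Relation.Binary.Sublist.Propositional using (_⊆_; []; _∷_; _∷ʳ_; ⊆-refl; minimum)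
open import Data.List.Relation.Binary.Sublist.Propositional.Properties using (All-resp-⊆)
open import Data.List.Relation.Unary.All as All using (All; []; _∷_; all?)
open import Data.List.Relation.Unary.All.Properties using (¬All⇒Any¬; ¬Any⇒All¬)
open import Data.List.Relation.Unary.AllPairs as AllPairs using (AllPairs; []; _∷_)
import Data.List.Relation.Unary.AllPairs.Properties as AllPairs
open import Data.List.Relation.Unary.Any as Any using (Any; here; there; any?)
open import Data.List.Relation.Unary.Any.Properties using (lookup-index)
open import Data.List.Relation.Unary.Unique.Propositional using (Unique)
import Data.List.Relation.Unary.Unique.Propositional.Properties as Unique
open import Data.Maybe using (just)
open import Data.Maybe.Properties using (just-injective)
open import Data.Nat
open import Data.List.Membership.DecPropositional _≟_ using (_∈?_)
open import Data.Nat.Induction using (<-rec)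
open import Data.Nat.ListAction using (sum)
open import Data.Nat.ListAction.Properties using (sum-++)
open import Data.Nat.Properties
open import Data.Product using (_×_; _,_; proj₁; proj₂; ∃; ∃₂)
open import Data.Sum as Sum using (_⊎_; inj₁; inj₂)
open import Function using (_∘_; id; Inverse; Equivalence; mk⇔)
import Function.Construct.Composition as Composition
import Function.Construct.Symmetry as Symmetry
open import Level using (0ℓ)
open import Relation.Binary.PropositionalEquality
open import Relation.Nullary using (Dec; yes; no; ¬_; contradiction)
open import Relation.Nullary.Decidable using (_×-dec_; ¬?)
open import Relation.Unary using (Pred; _≐_; ∅; Decidable)

-- Sums over selections, arrangements and splittings of a list

selSum : (ℕ → List ℕ → ℕ) → List ℕ → ℕ
selSum g []      = 0
selSum g (x ∷ X) = g x X + selSum (λ y Y → g y (x ∷ Y)) X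

-- A sum over the ordered selections of k letters from X; for k = length X these
-- are the arrangements of X.
permSum : (List ℕ → ℕ) → ℕ → List ℕ → ℕ
permSum f zero    X = f []
permSum f (suc k) X = selSum (λ x Y → permSum (λ w → f (x ∷ w)) k Y) X

-- The sum over the ways to share out X between a subsequence Y of length p and its complement Z.
-- Both keep the order of X, so the parts of an increasing alphabet are increasing.
splitSum : (List ℕ → List ℕ → ℕ) → ℕ → List ℕ → ℕ
splitSum g zero    X       = g [] X
splitSum g (suc p) []      = 0
splitSum g (suc p) (x ∷ X) =
  splitSum (λ Y Z → g (x ∷ Y) Z) p X + splitSum (λ Y Z → g Y (x ∷ Z)) (suc p) X

selSum-cong : ∀ {g h} → (∀ x X → g x X ≡ h x X) → ∀ X → selSum g X ≡ selSum h X
selSum-cong e []      = refl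
selSum-cong e (x ∷ X) = cong₂ _+_ (e x X) (selSum-cong (λ y Y → e y (x ∷ Y)) X)

selSum-+ : ∀ g h X → selSum (λ x Y → g x Y + h x Y) X ≡ selSum g X + selSum h X
selSum-+ g h []      = refl
selSum-+ g h (x ∷ X) =
  trans (cong (g x X + h x X +_) (selSum-+ _ _ X)) (interchange +-commutativeSemigroup (g x X) (h x X) _ _)

selSum-*ˡ : ∀ c g X → selSum (λ x Y → c * g x Y) X ≡ c * selSum g X
selSum-*ˡ c g []      = sym (*-zeroʳ c)
selSum-*ˡ c g (x ∷ X) =
  trans (cong (c * g x X +_) (selSum-*ˡ c _ X)) (sym (*-distribˡ-+ c (g x X) _))

permSum-cong : ∀ {f g} k → (∀ w → length w ≡ k → f w ≡ g w) → ∀ X → permSum f k X ≡ permSum g k X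
permSum-cong zero    e X = e [] refl
permSum-cong (suc k) e X =
  selSum-cong (λ x Y → permSum-cong k (λ w l → e (x ∷ w) (cong suc l)) Y) X

permSum-+ : ∀ f g k X → permSum (λ w → f w + g w) k X ≡ permSum f k X + permSum g k X
permSum-+ f g zero    X = refl
permSum-+ f g (suc k) X =
  trans (selSum-cong (λ x Y → permSum-+ _ _ k Y) X) (selSum-+ _ _ X)

permSum-*ˡ : ∀ c f k X → permSum (λ w → c * f w) k X ≡ c * permSum f k X
permSum-*ˡ c f zero    X = refl
permSum-*ˡ c f (suc k) X =
  trans (selSum-cong (λ x Y → permSum-*ˡ c _ k Y) X) (selSum-*ˡ c _ X)

permSum-*ʳ : ∀ f c k X → permSum (λ w → f w * c) k X ≡ permSum f k X * c
permSum-*ʳ f c k X = trans (permSum-cong k (λ w _ → *-comm (f w) c) X)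
  (trans (permSum-*ˡ c f k X) (*-comm c _))

permSum-zero : ∀ {f} k X → (∀ w → length w ≡ k → f w ≡ 0) → permSum f k X ≡ 0
permSum-zero {f} k X e = trans (permSum-cong {g = λ _ → 0 * 0} k e X) (permSum-*ˡ 0 (λ _ → 0) k X)

module _ (R : ℕ → ℕ → Set) where

  selSum-param : ∀ {g h} → (∀ {x y X Y} → R x y → Pointwise R X Y → g x X ≡ h y Y) →
                 ∀ {X Y} → Pointwise R X Y → selSum g X ≡ selSum h Y
  selSum-param e []       = refl
  selSum-param e (r ∷ rs) =
    cong₂ _+_ (e r rs) (selSum-param (λ r′ rs′ → e r′ (r ∷ rs′)) rs)

  -- Relational parametricity: the summation never inspects a letter, so only `f` and `g` have to
  -- respect R. This is what allows an alphabet to be relabelled.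
  permSum-param : ∀ {f g} k → (∀ {u v} → Pointwise R u v → f u ≡ g v) →
                  ∀ {X Y} → Pointwise R X Y → permSum f k X ≡ permSum g k Y
  permSum-param zero    e rs = e []
  permSum-param (suc k) e rs =
    selSum-param (λ r rs′ → permSum-param k (λ us → e (r ∷ us)) rs′) rs

splitSum-cong : ∀ {g h} p X →
  (∀ {Y Z} → Y ⊆ X → Z ⊆ X → length Y ≡ p → length Y + length Z ≡ length X → g Y Z ≡ h Y Z) →
  splitSum g p X ≡ splitSum h p X
splitSum-cong zero    X       e = e (minimum X) ⊆-refl refl refl
splitSum-cong (suc p) []      e = refl
splitSum-cong (suc p) (x ∷ X) e = cong₂ _+_
  (splitSum-cong p X λ s t l l′ → e (refl ∷ s) (x ∷ʳ t) (cong suc l) (cong suc l′))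
  (splitSum-cong (suc p) X λ {Y} {Z} s t l l′ →
    e (x ∷ʳ s) (refl ∷ t) l (trans (+-suc (length Y) (length Z)) (cong suc l′)))

splitSum-+ : ∀ g h p X → splitSum (λ Y Z → g Y Z + h Y Z) p X ≡ splitSum g p X + splitSum h p X
splitSum-+ g h zero    X       = refl
splitSum-+ g h (suc p) []      = refl
splitSum-+ g h (suc p) (x ∷ X) =
  trans (cong₂ _+_ (splitSum-+ _ _ p X) (splitSum-+ _ _ (suc p) X))
        (interchange +-commutativeSemigroup (splitSum _ p X) (splitSum _ p X) _ _)

-- Double counting of p + 1 chosen letters with one of them marked: the marked letter can be picked
-- after the others are chosen or before.
splitSum-selSum : ∀ (g : ℕ → List ℕ → List ℕ → ℕ) p X →
  splitSum (λ Y Z → selSum (λ y Y′ → g y Y′ Z) Y) (suc p) X ≡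
  selSum (λ x X′ → splitSum (g x) p X′) X
splitSum-selSum g p       []      = refl
splitSum-selSum g zero    (x ∷ X) =
  cong₂ _+_ (+-identityʳ (g x [] X)) (splitSum-selSum (λ y Y Z → g y Y (x ∷ Z)) zero X)
splitSum-selSum g (suc p) (x ∷ X) = begin
  splitSum (λ Y Z → g x Y Z + selSum (λ y Y′ → g y (x ∷ Y′) Z) Y) (suc p) X + R
    ≡⟨ cong (_+ R) (splitSum-+ _ _ (suc p) X) ⟩
  G + splitSum (λ Y Z → selSum (λ y Y′ → g y (x ∷ Y′) Z) Y) (suc p) X + R
    ≡⟨ cong₂ (λ a b → G + a + b) (splitSum-selSum (λ y Y Z → g y (x ∷ Y) Z) p X)
         (splitSum-selSum (λ y Y Z → g y Y (x ∷ Z)) (suc p) X) ⟩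
  G + A + B
    ≡⟨ +-assoc G A B ⟩
  G + (A + B)
    ≡⟨ cong (G +_) (selSum-+ _ _ X) ⟨
  G + selSum (λ y X′ → splitSum (g y) (suc p) (x ∷ X′)) X ∎
  where
  open ≡-Reasoning
  R = splitSum (λ Y Z → selSum (λ y Y′ → g y Y′ (x ∷ Z)) Y) (suc (suc p)) X
  G = splitSum (g x) (suc p) X
  A = selSum (λ y X′ → splitSum (λ Y Z → g y (x ∷ Y) Z) p X′) X
  B = selSum (λ y X′ → splitSum (λ Y Z → g y Y (x ∷ Z)) (suc p) X′) X

-- The arrangements are grouped by the letters Y that fill the first p places. In the induction on
-- p, `splitSum-selSum` moves the choice of the first letter inside the choice of Y.
permSum-split : ∀ f p q X →
  permSum f (p + q) X ≡
  splitSum (λ Y Z → permSum (λ u → permSum (λ v → f (u ++ v)) q Z) p Y) p X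
permSum-split f zero    q X = refl
permSum-split f (suc p) q X = trans
  (selSum-cong (λ x X′ → permSum-split (λ w → f (x ∷ w)) p q X′) X)
  (sym (splitSum-selSum
    (λ x Y Z → permSum (λ u → permSum (λ v → f (x ∷ u ++ v)) q Z) p Y) p X))

-- Standardization and order isomorphisms

below : ℕ → List ℕ → ℕ
below x w = length (filter (_<? x) w)

below-yes : ∀ {a x} w → a < x → below x (a ∷ w) ≡ suc (below x w)
below-yes w a<x = cong length (filter-accept (_<? _) {xs = w} a<x)

below-no : ∀ {a x} w → ¬ a < x → below x (a ∷ w) ≡ below x w
below-no w a≮x = cong length (filter-reject (_<? _) {xs = w} a≮x)

-- Comparisons are both preserved and reflected, so that passing to related words neither adds to
-- nor removes from the letters that `below` counts.
OrderPreserving : (ℕ → ℕ → Set) → Set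
OrderPreserving R = ∀ {x y x′ y′} → R x y → R x′ y′ → (x < x′ → y < y′) × (y < y′ → x < x′)

module _ {R : ℕ → ℕ → Set} (mono : OrderPreserving R) where

  below-param : ∀ {x y u v} → R x y → Pointwise R u v → below x u ≡ below y v
  below-param r [] = refl
  below-param {x} r (_∷_ {x = a} {xs = u} {ys = v} s ps) with a <? x
  ... | yes a<x = trans (below-yes u a<x)
                    (trans (cong suc (below-param r ps)) (sym (below-yes v (proj₁ (mono s r) a<x))))
  ... | no a≮x  = trans (below-no u a≮x)
                    (trans (below-param r ps) (sym (below-no v (a≮x ∘ proj₂ (mono s r)))))

  st-param : ∀ {u v} → Pointwise R u v → st u ≡ st v
  st-param {u} {v} rs = go rs
    where
    go : ∀ {u′ v′} → Pointwise R u′ v′ →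
         map (λ x → suc (below x u)) u′ ≡ map (λ y → suc (below y v)) v′
    go []       = refl
    go (r ∷ ps) = cong₂ _∷_ (cong suc (below-param r rs)) (go ps)

Pointwise-take : ∀ {R : ℕ → ℕ → Set} n {u v} → Pointwise R u v → Pointwise R (take n u) (take n v)
Pointwise-take zero    rs       = []
Pointwise-take (suc n) []       = []
Pointwise-take (suc n) (r ∷ rs) = r ∷ Pointwise-take n rs

Pointwise-drop : ∀ {R : ℕ → ℕ → Set} n {u v} → Pointwise R u v → Pointwise R (drop n u) (drop n v)
Pointwise-drop zero    rs       = rs
Pointwise-drop (suc n) []       = []
Pointwise-drop (suc n) (r ∷ rs) = Pointwise-drop n rs

below-≤ : ∀ {x y} w → x ≤ y → below x w ≤ below y w
below-≤ [] _ = z≤n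
below-≤ {x} {y} (a ∷ w) x≤y with a <? x | a <? y
... | yes a<x | yes a<y =
  subst₂ _≤_ (sym (below-yes w a<x)) (sym (below-yes w a<y)) (s≤s (below-≤ w x≤y))
... | no a≮x  | yes a<y =
  subst₂ _≤_ (sym (below-no w a≮x)) (sym (below-yes w a<y)) (m≤n⇒m≤1+n (below-≤ w x≤y))
... | no a≮x  | no a≮y  =
  subst₂ _≤_ (sym (below-no w a≮x)) (sym (below-no w a≮y)) (below-≤ w x≤y)
... | yes a<x | no a≮y  = contradiction (<-≤-trans a<x x≤y) a≮y

-- The letter x itself is counted below y but not below x, hence the strictness.
below-< : ∀ {x y} w → x ∈ w → x < y → below x w < below y w
below-< (a ∷ w) (here refl) x<y =
  subst₂ _<_ (sym (below-no w (<-irrefl refl))) (sym (below-yes w x<y)) (s≤s (below-≤ w (<⇒≤ x<y)))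
below-< {x} {y} (a ∷ w) (there x∈w) x<y with a <? x | a <? y
... | yes a<x | yes a<y =
  subst₂ _<_ (sym (below-yes w a<x)) (sym (below-yes w a<y)) (s≤s (below-< w x∈w x<y))
... | no a≮x  | yes a<y =
  subst₂ _<_ (sym (below-no w a≮x)) (sym (below-yes w a<y)) (m≤n⇒m≤1+n (below-< w x∈w x<y))
... | no a≮x  | no a≮y  =
  subst₂ _<_ (sym (below-no w a≮x)) (sym (below-no w a≮y)) (below-< w x∈w x<y)
... | yes a<x | no a≮y  = contradiction (<-trans a<x x<y) a≮y

-- The graph of the map that standardizes w. It is restricted to letters of w because only there is
-- the rank strictly increasing.
RankIn : List ℕ → ℕ → ℕ → Set
RankIn w x y = x ∈ w × y ≡ suc (below x w)

RankIn-order : ∀ w → OrderPreserving (RankIn w)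
RankIn-order w {x} {x′ = x′} (x∈w , refl) (x′∈w , refl) =
  (λ x<x′ → s<s (below-< w x∈w x<x′)) ,
  (λ b → ≰⇒> λ x′≤x → <⇒≱ (s<s⁻¹ b) (below-≤ w x′≤x))

st-RankIn : ∀ w → Pointwise (RankIn w) w (st w)
st-RankIn w = go w (λ z → z)
  where
  go : ∀ v → (∀ {x} → x ∈ v → x ∈ w) → Pointwise (RankIn w) v (map (λ x → suc (below x w)) v)
  go []      _ = []
  go (x ∷ v) s = (s (here refl) , refl) ∷ go v (s ∘ there)

-- The words w and `st w` are order isomorphic letter by letter, hence so are their prefixes;
-- `st-drop` does the same for suffixes.
st-take : ∀ k w → st (take k (st w)) ≡ st (take k w)
st-take k w = sym (st-param (RankIn-order w) (Pointwise-take k (st-RankIn w)))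

st-drop : ∀ k w → st (drop k (st w)) ≡ st (drop k w)
st-drop k w = sym (st-param (RankIn-order w) (Pointwise-drop k (st-RankIn w)))

-- Relabelling increasing alphabets

Increasing : List ℕ → Set
Increasing = AllPairs _<_

AllPairs-⊆ : ∀ {R : ℕ → ℕ → Set} {X Y} → X ⊆ Y → AllPairs R Y → AllPairs R X
AllPairs-⊆ []         i        = i
AllPairs-⊆ (_ ∷ʳ s)   (_ ∷ i)  = AllPairs-⊆ s i
AllPairs-⊆ (refl ∷ s) (x∼ ∷ i) = All-resp-⊆ s x∼ ∷ AllPairs-⊆ s i

-- For increasing X and Y of equal length this is the order isomorphism between them.
Zipped : List ℕ → List ℕ → ℕ → ℕ → Set
Zipped X Y x y = (x , y) ∈ zip X Y

Zipped-order : ∀ {X Y} → Increasing X → Increasing Y → OrderPreserving (Zipped X Y)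
Zipped-order {[]}    {_}     _         _         ()
Zipped-order {_ ∷ _} {[]}    _         _         ()
Zipped-order {_ ∷ X} {_ ∷ Y} (x< ∷ iX) (y< ∷ iY) = go
  where
  member : ∀ {X Y : List ℕ} {x y} → (x , y) ∈ zip X Y → x ∈ X × y ∈ Y
  member {_ ∷ _} {_ ∷ _} (here refl) = here refl , here refl
  member {_ ∷ _} {_ ∷ _} (there z)   = there (proj₁ (member z)) , there (proj₂ (member z))

  go : OrderPreserving (Zipped (_ ∷ X) (_ ∷ Y))
  go (here refl) (here refl) =
    (λ l → contradiction l (<-irrefl refl)) , (λ l → contradiction l (<-irrefl refl))
  go (here refl) (there z)   =
    (λ _ → All.lookup y< (proj₂ (member z))) , (λ _ → All.lookup x< (proj₁ (member z)))
  go (there z)   (here refl) =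
    (λ l → contradiction l (<⇒≯ (All.lookup x< (proj₁ (member z))))) ,
    (λ l → contradiction l (<⇒≯ (All.lookup y< (proj₂ (member z)))))
  go (there z)   (there z′)  = Zipped-order iX iY z z′

zipped : ∀ {X Y} → length X ≡ length Y → Pointwise (Zipped X Y) X Y
zipped {[]}    {[]}    _ = []
zipped {_ ∷ _} {_ ∷ _} l = here refl ∷ Pointwise.map there (zipped (suc-injective l))

-- Indicators and weighted counts of words

χ : {P : Set} → Dec P → ℕ
χ (yes _) = 1
χ (no _)  = 0

χ-yes : {P : Set} (d : Dec P) → P → χ d ≡ 1
χ-yes (yes _) _ = refl
χ-yes (no ¬p) p = contradiction p ¬p

χ-no : {P : Set} (d : Dec P) → ¬ P → χ d ≡ 0
χ-no (yes p) ¬p = contradiction p ¬p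
χ-no (no _)  _  = refl

χ-split : {P : Set} (d : Dec P) → (1 ∸ χ d) + χ d ≡ 1
χ-split (yes _) = refl
χ-split (no _)  = refl

χ-⇔ : {P Q : Set} (d : Dec P) (d′ : Dec Q) → (P → Q) → (Q → P) → χ d ≡ χ d′
χ-⇔ (yes p) d′ f g = sym (χ-yes d′ (f p))
χ-⇔ (no ¬p) d′ f g = sym (χ-no d′ (¬p ∘ g))

χ-× : {P Q R : Set} (d : Dec P) (d′ : Dec Q) (d″ : Dec R) → (P → Q → R) → (R → P × Q) → χ d * χ d′ ≡ χ d″
χ-× (yes p) (yes q) d″ f g = sym (χ-yes d″ (f p q))
χ-× (yes p) (no ¬q) d″ f g = sym (χ-no d″ (¬q ∘ proj₂ ∘ g))
χ-× (no ¬p) d′      d″ f g = sym (χ-no d″ (¬p ∘ proj₁ ∘ g))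

χ-¬ : {P : Set} (d : Dec P) → 1 ∸ χ d ≡ χ (¬? d)
χ-¬ (yes _) = refl
χ-¬ (no _)  = refl

-- Written with `tabulate`, as `word` is, so that arrangements of these letters can be matched with
-- permutations.
letters : ℕ → List ℕ
letters n = tabulate {n = n} (suc ∘ toℕ)

letters-increasing : ∀ n → Increasing (letters n)
letters-increasing n = AllPairs.tabulate⁺-< s<s

length-letters : ∀ n → length (letters n) ≡ n
length-letters n = length-tabulate {n = n} (suc ∘ toℕ)

drop-++ : ∀ (u v : List ℕ) t → drop (length u + t) (u ++ v) ≡ drop t v
drop-++ []      v t = refl
drop-++ (_ ∷ u) v t = drop-++ u v t

take-drop-++ : ∀ m t (u v : List ℕ) → t + m ≤ length u → take m (drop t (u ++ v)) ≡ take m (drop t u)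
take-drop-++ zero    zero    u       v l = refl
take-drop-++ (suc m) zero    (x ∷ u) v l = cong (x ∷_) (take-drop-++ m zero u v (s≤s⁻¹ l))
take-drop-++ m       (suc t) (x ∷ u) v l = take-drop-++ m t u v (s≤s⁻¹ l)

-- Positions t count from 0.  A factor that runs past the end of w is shorter
-- than m, hence is not an occurrence of a pattern of length m.
occurs? : ∀ m q t w → Dec (st (take m (drop t w)) ≡ q)
occurs? m q t w = ≡-dec _≟_ (st (take m (drop t w))) q

module Weights (m : ℕ) (q : List ℕ) where

  occ : ℕ → List ℕ → ℕ
  occ t w = χ (occurs? m q t w)

  occs nons : List ℕ → List ℕ → ℕ
  occs []      w = 1
  occs (t ∷ T) w = occ t w * occs T w
  nons []      w = 1
  nons (t ∷ T) w = (1 ∸ occ t w) * nons T w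

  occs-χ : ∀ T w → occs T w ≡ χ (all? (λ t → occurs? m q t w) T)
  occs-χ []      w = refl
  occs-χ (t ∷ T) w = trans (cong (occ t w *_) (occs-χ T w))
    (χ-× (occurs? m q t w) (all? (λ t → occurs? m q t w) T)
         (all? (λ t → occurs? m q t w) (t ∷ T)) _∷_ All.uncons)

  nons-χ : ∀ T w → nons T w ≡ χ (all? (λ t → ¬? (occurs? m q t w)) T)
  nons-χ []      w = refl
  nons-χ (t ∷ T) w = trans (cong₂ _*_ (χ-¬ (occurs? m q t w)) (nons-χ T w))
    (χ-× (¬? (occurs? m q t w)) (all? (λ t → ¬? (occurs? m q t w)) T)
         (all? (λ t → ¬? (occurs? m q t w)) (t ∷ T)) _∷_ All.uncons)

  weight : List ℕ → List ℕ → List ℕ → ℕ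
  weight A B w = occs A w * nons B w

  count : ℕ → List ℕ → List ℕ → ℕ
  count n A B = permSum (weight A B) n (letters n)

  count-split : ∀ n A x B → count n A (x ∷ B) + count n (x ∷ A) B ≡ count n A B
  count-split n A x B = trans (sym (permSum-+ _ _ n (letters n)))
    (permSum-cong n (λ w _ → pointwise w) (letters n))
    where
    open ≡-Reasoning
    rearrange : ∀ a b c d → a * (b * c) + d * a * c ≡ (b + d) * (a * c)
    rearrange a b c d = begin
      a * (b * c) + d * a * c   ≡⟨ cong₂ _+_ (sym (*-assoc a b c)) (*-assoc d a c) ⟩
      a * b * c + d * (a * c)   ≡⟨ cong (λ z → z * c + d * (a * c)) (*-comm a b) ⟩
      b * a * c + d * (a * c)   ≡⟨ cong (_+ d * (a * c)) (*-assoc b a c) ⟩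
      b * (a * c) + d * (a * c) ≡⟨ *-distribʳ-+ (a * c) b d ⟨
      (b + d) * (a * c)         ∎
    pointwise : ∀ w → weight A (x ∷ B) w + weight (x ∷ A) B w ≡ weight A B w
    pointwise w = begin
      weight A (x ∷ B) w + weight (x ∷ A) B w
        ≡⟨ rearrange (occs A w) (1 ∸ occ x w) (nons B w) (occ x w) ⟩
      ((1 ∸ occ x w) + occ x w) * weight A B w
        ≡⟨ cong (_* weight A B w) (χ-split (occurs? m q x w)) ⟩
      1 * weight A B w
        ≡⟨ *-identityˡ _ ⟩
      weight A B w ∎

  occ-param : ∀ {R} → OrderPreserving R → ∀ t {u v} → Pointwise R u v → occ t u ≡ occ t v
  occ-param mono t rs =
    cong (λ s → χ (≡-dec _≟_ s q)) (st-param mono (Pointwise-take m (Pointwise-drop t rs)))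

  occs-param : ∀ {R} → OrderPreserving R → ∀ T {u v} → Pointwise R u v → occs T u ≡ occs T v
  occs-param mono []      rs = refl
  occs-param mono (t ∷ T) rs = cong₂ _*_ (occ-param mono t rs) (occs-param mono T rs)

  -- Occurrences depend on relative order alone, so the size of an increasing alphabet determines
  -- the sum.
  occs-alphabet : ∀ T {X Y} k → Increasing X → Increasing Y → length X ≡ length Y →
    permSum (occs T) k X ≡ permSum (occs T) k Y
  occs-alphabet T k iX iY l =
    permSum-param _ k (occs-param (Zipped-order iX iY) T) (zipped l)

  occ-++ˡ : ∀ t u v → t + m ≤ length u → occ t (u ++ v) ≡ occ t u
  occ-++ˡ t u v l = cong (λ f → χ (≡-dec _≟_ (st f) q)) (take-drop-++ m t u v l)

  occ-++ʳ : ∀ t u v → occ (length u + t) (u ++ v) ≡ occ t v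
  occ-++ʳ t u v = cong (λ f → χ (≡-dec _≟_ (st (take m f)) q)) (drop-++ u v t)

  occs-zero : ∀ {t T} w → t ∈ T → occ t w ≡ 0 → occs T w ≡ 0
  occs-zero w (here refl) e = cong (_* _) e
  occs-zero {T = s ∷ _} w (there t∈T) e = trans (cong (occ s w *_) (occs-zero w t∈T e)) (*-zeroʳ (occ s w))

  module _ (lq : length q ≡ m) where

    occurs-range : ∀ t w → 1 ≤ m → st (take m (drop t w)) ≡ q → t + m ≤ length w
    occurs-range t w 1≤m e = bound (subst (m ≤_) (length-drop t w) m≤)
      where
      m≤ : m ≤ length (drop t w)
      m≤ = m⊓n≡m⇒m≤n (trans (sym (trans (length-map _ (take m (drop t w))) (length-take m (drop t w))))
                            (trans (cong length e) lq))
      bound : m ≤ length w ∸ t → t + m ≤ length w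
      bound b with t ≤? length w
      ... | yes t≤ = subst (_≤ length w) (+-comm m t)
                       (≤-trans (+-monoˡ-≤ t b) (≤-reflexive (m∸n+n≡m t≤)))
      -- Truncated subtraction makes `length w ∸ t` zero here, against `1 ≤ m`.
      ... | no t≰  = contradiction (≤-trans 1≤m (subst (m ≤_) (m≤n⇒m∸n≡0 (≰⇒≥ t≰)) b)) λ ()

-- Cutting words, and clusters of occurrences

open Weights

-- T₁ consists of the occurrences inside the first k letters and T₂ of those
-- inside the rest, shifted back by k.
occs-cut : ∀ m k T → All (λ t → t + m ≤ k ⊎ k ≤ t) T →
  ∃₂ λ T₁ T₂ → ∀ q u v → length u ≡ k →
  occs m q T (u ++ v) ≡ occs m q T₁ u * occs m q T₂ v
occs-cut m k []      []       = [] , [] , λ _ _ _ _ → refl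
occs-cut m k (t ∷ T) (c ∷ cs) with occs-cut m k T cs | c
... | T₁ , T₂ , e | inj₁ t+m≤k = t ∷ T₁ , T₂ , λ { q u v refl →
  trans (cong₂ _*_ (occ-++ˡ m q t u v t+m≤k) (e q u v refl)) (sym (*-assoc (occ m q t u) _ _)) }
... | T₁ , T₂ , e | inj₂ k≤t = T₁ , (t ∸ k) ∷ T₂ , λ { q u v refl →
  trans (cong₂ _*_ (trans (cong (λ i → occ m q i (u ++ v)) (sym (m+[n∸m]≡n k≤t)))
                          (occ-++ʳ m q (t ∸ length u) u v))
                   (e q u v refl))
        (swap (occ m q (t ∸ length u) v) (occs m q T₁ u) _) }
  where
  swap : ∀ a b c → a * (b * c) ≡ b * (a * c)
  swap a b c = trans (sym (*-assoc a b c)) (trans (cong (_* c) (*-comm a b)) (*-assoc b a c))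

-- The positions of a chain of occurrences that covers a word of length n, each
-- sharing exactly one letter with the next.
record Cluster (m n : ℕ) (T : List ℕ) : Set where
  field
    inRange   : ∀ {t} → t ∈ T → t + m ≤ n
    connected : ∀ {k} → 0 < k → k < n → ∃ λ t → t ∈ T × t < k × k < t + m
    sparse    : ∀ {s t} → s ∈ T → t ∈ T → s < t → s + m ≤ suc t

open Cluster

-- Strong induction on x. Say that t spans the cut at k if t < k < t + m. For x > 0, some t in T
-- spans x and some t′ in T′ spans x + 1. If t′ is not x, then t′ < x, and sparseness of T gives t <
-- t′. By induction t lies in T′, so sparseness of T′ gives t + m ≤ t′ + 1 ≤ x, and t cannot span x.
cluster-⊆ : ∀ {m n T T′} → 2 ≤ m → Cluster m n T → Cluster m n T′ → ∀ x → x ∈ T → x ∈ T′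
cluster-⊆ {m} {n} {T} {T′} 2≤m c c′ = <-rec (λ x → x ∈ T → x ∈ T′) step
  where
  2+x≤n : ∀ {x} → x ∈ T → suc (suc x) ≤ n
  2+x≤n {x} x∈T = ≤-trans (subst (_≤ x + m) (+-comm x 2) (+-monoʳ-≤ x 2≤m)) (inRange c x∈T)

  step : ∀ x → (∀ {y} → y < x → y ∈ T → y ∈ T′) → x ∈ T → x ∈ T′
  -- Only position 0 can span the cut at 1.
  step zero    _  x∈T with connected c′ {1} z<s (2+x≤n x∈T)
  ... | zero , t∈T′ , _ = t∈T′
  ... | suc _ , _ , s<s () , _
  step x@(suc _) ih x∈T with connected c z<s (<⇒≤ (2+x≤n x∈T)) | connected c′ {suc x} z<s (2+x≤n x∈T)
  ... | t , t∈T , t<x , x<t+m | t′ , t′∈T′ , t′<1+x , 1+x<t′+m with m≤n⇒m<n∨m≡n (s≤s⁻¹ t′<1+x)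
  ... | inj₂ refl  = t′∈T′
  ... | inj₁ t′<x  =
    contradiction (≤-trans x<t+m (≤-trans (sparse c′ (ih t<x t∈T) t′∈T′ t<t′) t′<x)) (<-irrefl refl)
    where
    t<t′ : t < t′
    t<t′ = +-cancelʳ-< m t t′ (≤-<-trans (sparse c t∈T x∈T t<x) 1+x<t′+m)

-- Two occurrences of q in the same word share at most one letter.
Separated : ℕ → List ℕ → Set
Separated m q = ∀ {s t} w → s < t → suc t < s + m →
  st (take m (drop s w)) ≡ q → st (take m (drop t w)) ≡ q → ⊥

-- Equality of the counts, by induction on the word length

module FixedLength (m : ℕ) (2≤m : 2 ≤ m) where

  module Pattern (q : List ℕ) (lq : length q ≡ m) (sep : Separated m q) where

    -- The number b(n,T) for the pattern q.
    atLeast : ℕ → List ℕ → ℕ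
    atLeast n T = permSum (occs m q T) n (letters n)

    atLeast-range : ∀ n {T} → Any (λ t → ¬ t + m ≤ n) T → atLeast n T ≡ 0
    atLeast-range n far = let t , t∈T , t≰ = find far in
      permSum-zero n (letters n) λ { w refl → occs-zero m q w t∈T
        (χ-no (occurs? m q t w) (t≰ ∘ occurs-range m q lq t w (<⇒≤ 2≤m))) }

    atLeast-close : ∀ n {s t T} → s ∈ T → t ∈ T → s < t → suc t < s + m → atLeast n T ≡ 0
    atLeast-close n {s} {t} {T} s∈T t∈T s<t close = permSum-zero n (letters n) λ w _ → zeroAt w
      where
      zeroAt : ∀ w → occs m q T w ≡ 0
      zeroAt w with occurs? m q s w
      ... | yes os = occs-zero m q w t∈T (χ-no (occurs? m q t w) (sep w s<t close os))
      ... | no ¬os = occs-zero m q w s∈T (χ-no (occurs? m q s w) ¬os)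

    -- Once the letters Y of the first part are fixed, the weight is a product, so the double sum
    -- over both parts factors.
    atLeast-cut : ∀ k l T T₁ T₂ →
      (∀ u v → length u ≡ k → occs m q T (u ++ v) ≡ occs m q T₁ u * occs m q T₂ v) →
      atLeast (k + l) T ≡
      splitSum (λ Y Z → permSum (occs m q T₁) k Y * permSum (occs m q T₂) l Z) k (letters (k + l))
    atLeast-cut k l T T₁ T₂ e = trans (permSum-split _ k l L) (splitSum-cong k L λ {Y} {Z} _ _ _ _ →
      trans (permSum-cong k (λ u lu → trans (permSum-cong l (λ v _ → e u v lu) Z)
                                              (permSum-*ˡ (occs m q T₁ u) (occs m q T₂) l Z)) Y)
            (permSum-*ʳ (occs m q T₁) (permSum (occs m q T₂) l Z) k Y))
      where L = letters (k + l)

    atLeast-letters : ∀ k T X → Increasing X → length X ≡ k → permSum (occs m q T) k X ≡ atLeast k T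
    atLeast-letters k T X iX lX =
      occs-alphabet m q T k iX (letters-increasing k) (trans lX (sym (length-letters k)))

    -- The product `occs` is the indicator of a conjunction, so neither order nor repetition in the
    -- list matters.
    atLeast-set : ∀ n {S T} → (∀ {x} → x ∈ S → x ∈ T) → (∀ {x} → x ∈ T → x ∈ S) →
      atLeast n S ≡ atLeast n T
    atLeast-set n {S} {T} S⊆T T⊆S = permSum-cong n (λ w _ →
      trans (occs-χ m q S w) (trans (χ-⇔ (all? (λ t → occurs? m q t w) S) (all? (λ t → occurs? m q t w) T)
          (λ a → All.tabulate (All.lookup a ∘ T⊆S)) (λ a → All.tabulate (All.lookup a ∘ S⊆T)))
        (sym (occs-χ m q T w)))) (letters n)

    count-[] : ∀ n T → count m q n T [] ≡ atLeast n T
    count-[] n T = permSum-cong n (λ w _ → *-identityʳ _) (letters n)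

  module Pair (p q : List ℕ) (lp : length p ≡ m) (lq : length q ≡ m)
             (sp : Separated m p) (sq : Separated m q)
             (avoid : ∀ n → count m p n [] (upTo n) ≡ count m q n [] (upTo n)) where

    module P = Pattern p lp sp
    module Q = Pattern q lq sq

    Balanced : ℕ → List ℕ → Set
    Balanced n T = P.atLeast n T ≡ Q.atLeast n T

    -- In `occs-cut`, T₁ and T₂ are found before the pattern is given. Both patterns therefore
    -- reduce to the same two shorter problems, and relabelling brings each part back to its
    -- standard alphabet.
    balanced-cut : ∀ n → (∀ {l} → l < n → ∀ T → Balanced l T) → ∀ {k} T → 0 < k → k < n →
                   All (λ t → ¬ (t < k × k < t + m)) T → Balanced n T
    balanced-cut n ih {k} T 0<k k<n ¬across with m≤n⇒∃[o]m+o≡n (<⇒≤ k<n)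
    ... | l , refl with occs-cut m k T (All.map side ¬across)
      where
      side : ∀ {t} → ¬ (t < k × k < t + m) → t + m ≤ k ⊎ k ≤ t
      side {t} ¬a with t <? k | k <? t + m
      ... | yes a | yes b = contradiction (a , b) ¬a
      ... | no ¬a | _     = inj₂ (≮⇒≥ ¬a)
      ... | _     | no ¬b = inj₁ (≮⇒≥ ¬b)
    ... | T₁ , T₂ , e =
      trans (P.atLeast-cut k l T T₁ T₂ (e p))
        (trans (splitSum-cong k (letters (k + l)) agree) (sym (Q.atLeast-cut k l T T₁ T₂ (e q))))
      where
      l<n : l < k + l
      l<n = +-monoˡ-≤ l 0<k
      agree : ∀ {Y Z} → _ → _ → length Y ≡ k → length Y + length Z ≡ length (letters (k + l)) → _
      agree {Y} {Z} Y⊆ Z⊆ lY lYZ = cong₂ _*_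
        (trans (P.atLeast-letters k T₁ Y iY lY) (trans (ih k<n T₁) (sym (Q.atLeast-letters k T₁ Y iY lY))))
        (trans (P.atLeast-letters l T₂ Z iZ lZ) (trans (ih l<n T₂) (sym (Q.atLeast-letters l T₂ Z iZ lZ))))
        where
        iY = AllPairs-⊆ Y⊆ (letters-increasing (k + l))
        iZ = AllPairs-⊆ Z⊆ (letters-increasing (k + l))
        lZ : length Z ≡ l
        lZ = +-cancelˡ-≡ k _ _ (trans (cong (_+ length Z) (sym lY)) (trans lYZ (length-letters (k + l))))

    -- The fields of `Cluster` are tested in turn, and each failure balances T: a position out of
    -- range or two positions too close make both counts 0, and a cut that no occurrence spans
    -- allows `balanced-cut`.
    balanced-or-cluster : ∀ n → (∀ {l} → l < n → ∀ T → Balanced l T) →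
                          ∀ T → Balanced n T ⊎ Cluster m n T
    balanced-or-cluster n ih T with all? (λ t → t + m ≤? n) T
    ... | no ¬range = inj₁ (trans (P.atLeast-range n far) (sym (Q.atLeast-range n far)))
      where far = ¬All⇒Any¬ (λ t → t + m ≤? n) T ¬range
    ... | yes range with anyUpTo? (λ k → (0 <? k) ×-dec ¬? (any? (λ t → (t <? k) ×-dec (k <? t + m)) T)) n
    ... | yes (k , k<n , 0<k , ¬across) = inj₁ (balanced-cut n ih T 0<k k<n (¬Any⇒All¬ T ¬across))
    ... | no noCut with any? (λ s → any? (λ t → (s <? t) ×-dec (suc t <? s + m)) T) T
    ... | yes close =
      let s , s∈T , closeₛ = find close
          t , t∈T , s<t , t<s+m = find closeₛ
      in inj₁ (trans (P.atLeast-close n s∈T t∈T s<t t<s+m) (sym (Q.atLeast-close n s∈T t∈T s<t t<s+m)))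
    ... | no ¬close = inj₂ record
      { inRange   = All.lookup range
      ; connected = λ {k} 0<k k<n → across k 0<k k<n
      ; sparse    = λ s∈T t∈T s<t → ≮⇒≥ λ l → ¬close (lose s∈T (lose t∈T (s<t , l)))
      }
      where
      across : ∀ k → 0 < k → k < n → ∃ λ t → t ∈ T × t < k × k < t + m
      across k 0<k k<n with any? (λ t → (t <? k) ×-dec (k <? t + m)) T
      ... | yes a = find a
      ... | no ¬a = contradiction (k , k<n , 0<k , ¬a) noCut

    SameWeight : ℕ → List ℕ → List ℕ → Set
    SameWeight n A B = count m p n A B ≡ count m q n A B

    sameWeight-[] : ∀ n T → Balanced n T → SameWeight n T []
    sameWeight-[] n T e = trans (P.count-[] n T) (trans e (sym (Q.count-[] n T)))

    -- `count-split` relates three counts, so agreement for two of them forces it for the third.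
    -- `add-included` and `unexclude` solve for the other two.
    drop-excluded : ∀ n A x B → SameWeight n A B → SameWeight n (x ∷ A) B → SameWeight n A (x ∷ B)
    drop-excluded n A x B e e′ = +-cancelʳ-≡ (count m p n (x ∷ A) B) _ _
      (trans (count-split m p n A x B) (trans e (trans (sym (count-split m q n A x B))
        (cong (count m q n A (x ∷ B) +_) (sym e′)))))

    -- Removing forbidden positions one by one produces only required sets between A and A ∪ B.
    -- Asking for balance just there lets `isolate` keep the cluster out.
    sameWeight : ∀ n A B →
      (∀ S → (∀ {x} → x ∈ A → x ∈ S) → (∀ {x} → x ∈ S → x ∈ A ⊎ x ∈ B) → Balanced n S) →
                 SameWeight n A B
    sameWeight n A []      b = sameWeight-[] n A (b A id inj₁)
    sameWeight n A (x ∷ B) b = drop-excluded n A x B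
      (sameWeight n A B λ S A⊆S S⊆ → b S A⊆S (Sum.map₂ there ∘ S⊆))
      (sameWeight n (x ∷ A) B λ S A⊆S S⊆ → b S (A⊆S ∘ there) (shift ∘ S⊆))
      where
      shift : ∀ {y} → y ∈ x ∷ A ⊎ y ∈ B → y ∈ A ⊎ y ∈ x ∷ B
      shift (inj₁ (here e))  = inj₂ (here e)
      shift (inj₁ (there i)) = inj₁ i
      shift (inj₂ i)         = inj₂ (there i)

    add-included : ∀ n A x B → SameWeight n A B → SameWeight n A (x ∷ B) → SameWeight n (x ∷ A) B
    add-included n A x B e e′ = +-cancelˡ-≡ (count m p n A (x ∷ B)) _ _
      (trans (count-split m p n A x B) (trans e (trans (sym (count-split m q n A x B))
        (cong (_+ count m q n (x ∷ A) B) (sym e′)))))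

    unexclude : ∀ n A x B → SameWeight n (x ∷ A) B → SameWeight n A (x ∷ B) → SameWeight n A B
    unexclude n A x B e e′ = trans (sym (count-split m p n A x B))
      (trans (cong₂ _+_ e′ e) (count-split m q n A x B))

    -- Any two clusters of a word of length n have the same positions, so at most
    -- one set T of positions is not balanced by induction.  Deciding the positions
    -- one at a time leads from A = ∅ to A = T, and the counts that are split off
    -- on the way involve no cluster.
    module _ (n : ℕ) (ih : ∀ {l} → l < n → ∀ T → Balanced l T)
             {T : List ℕ} (cluster : Cluster m n T) where

      balanced-unless : ∀ S → (Cluster m n S → ⊥) → Balanced n S
      balanced-unless S ¬c with balanced-or-cluster n ih S
      ... | inj₁ b = b
      ... | inj₂ c = contradiction c ¬c

      isolate : ∀ A B → Unique B → (∀ {x} → x ∈ A → ¬ x ∈ B) →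
                (∀ {x} → x ∈ A → x ∈ T) → (∀ {x} → x ∈ T → x ∈ A ⊎ x ∈ B) →
                SameWeight n A B →
                ∃ λ S → (∀ {x} → x ∈ S → x ∈ T) × (∀ {x} → x ∈ T → x ∈ S) × SameWeight n S []
      isolate A [] _ _ A⊆T T⊆ e = A , A⊆T , (λ i → Sum.[ id , (λ ()) ] (T⊆ i)) , e
      isolate A (x ∷ B) (x∉B ∷ uB) disj A⊆T T⊆ e with x ∈? T
      ... | yes x∈T = isolate (x ∷ A) B uB disj′ A⊆T′ (shift ∘ T⊆) (add-included n A x B
              -- No set S met here is a cluster: it would have to contain x, which is in neither A
              -- nor B.
              (sameWeight n A B λ S _ S⊆ → balanced-unless S λ c →
                 Sum.[ (λ i → disj i (here refl)) , (λ i → All.lookup x∉B i refl) ]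
                   (S⊆ (cluster-⊆ 2≤m cluster c x x∈T)))
              e)
        where
        disj′ : ∀ {y} → y ∈ x ∷ A → ¬ y ∈ B
        disj′ (here refl) j = All.lookup x∉B j refl
        disj′ (there i)   j = disj i (there j)
        A⊆T′ : ∀ {y} → y ∈ x ∷ A → y ∈ T
        A⊆T′ (here refl) = x∈T
        A⊆T′ (there i)   = A⊆T i
        shift : ∀ {y} → y ∈ A ⊎ y ∈ x ∷ B → y ∈ x ∷ A ⊎ y ∈ B
        shift (inj₁ i)         = inj₁ (there i)
        shift (inj₂ (here e))  = inj₁ (here e)
        shift (inj₂ (there i)) = inj₂ i
      ... | no x∉T = isolate A B uB (λ i → disj i ∘ there) A⊆T shrink (unexclude n A x B
              -- Every S met here contains x; were it a cluster, x would be in T.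
              (sameWeight n (x ∷ A) B λ S A⊆S _ → balanced-unless S λ c →
                 x∉T (cluster-⊆ 2≤m c cluster x (A⊆S (here refl))))
              e)
        where
        shrink : ∀ {y} → y ∈ T → y ∈ A ⊎ y ∈ B
        shrink i with T⊆ i
        ... | inj₁ j           = inj₁ j
        ... | inj₂ (here refl) = contradiction i x∉T
        ... | inj₂ (there j)   = inj₂ j

      balanced-cluster : Balanced n T
      -- The start is a_{n,∅}: nothing required and every position forbidden, where `avoid` gives
      -- agreement.
      balanced-cluster with isolate [] (upTo n) (Unique.upTo⁺ n) (λ ()) (λ ()) (inj₂ ∘ T⊆upTo) (avoid n)
        where
        T⊆upTo : ∀ {x} → x ∈ T → x ∈ upTo n
        T⊆upTo {x} i = ∈-upTo⁺ (<-≤-trans (m<m+n x (<⇒≤ 2≤m)) (inRange cluster i))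
      ... | S , S⊆T , T⊆S , e =
        trans (P.atLeast-set n T⊆S S⊆T) (trans (sym (P.count-[] n S)) (trans e
          (trans (Q.count-[] n S) (Q.atLeast-set n S⊆T T⊆S))))

    balanced : ∀ n T → Balanced n T
    balanced = <-rec (λ n → ∀ T → Balanced n T) λ n ih T →
      Sum.[ id , balanced-cluster n ih ] (balanced-or-cluster n ih T)

    counts-agree : ∀ n A B → SameWeight n A B
    counts-agree n A B = sameWeight n A B λ S _ _ → balanced n S

-- Arrangements as an explicit list, and permutations

selections : (ℕ → List ℕ → List (List ℕ)) → List ℕ → List (List ℕ)
selections g []      = []
selections g (x ∷ X) = g x X ++ selections (λ y Y → g y (x ∷ Y)) X

-- Follows the recursion of `permSum`, so that a sum of indicators becomes the length of a filtered
-- list.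
arrangements : ℕ → List ℕ → List (List ℕ)
arrangements zero    X = [] ∷ []
arrangements (suc k) X = selections (λ x Y → map (x ∷_) (arrangements k Y)) X

sum-selections : ∀ f g X → sum (map f (selections g X)) ≡ selSum (λ x Y → sum (map f (g x Y))) X
sum-selections f g []      = refl
sum-selections f g (x ∷ X) = begin
  sum (map f (g x X ++ selections _ X))                ≡⟨ cong sum (map-++ f (g x X) _) ⟩
  sum (map f (g x X) ++ map f (selections _ X))        ≡⟨ sum-++ (map f (g x X)) _ ⟩
  sum (map f (g x X)) + sum (map f (selections _ X))   ≡⟨ cong (sum (map f (g x X)) +_) (sum-selections f _ X) ⟩
  sum (map f (g x X)) + selSum _ X                     ∎
  where open ≡-Reasoning

sum-arrangements : ∀ f k X → sum (map f (arrangements k X)) ≡ permSum f k X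
sum-arrangements f zero    X = +-identityʳ (f [])
sum-arrangements f (suc k) X = trans (sum-selections f _ X)
  (selSum-cong (λ x Y → trans (cong sum (sym (map-∘ (arrangements k Y)))) (sum-arrangements (f ∘ (x ∷_)) k Y)) X)

length-filter-χ : {A : Set} {P : Pred A 0ℓ} (P? : Decidable P) (xs : List A) →
  length (filter P? xs) ≡ sum (map (λ x → χ (P? x)) xs)
length-filter-χ P? []       = refl
length-filter-χ P? (x ∷ xs) with P? x
... | yes _ = cong suc (length-filter-χ P? xs)
... | no _  = length-filter-χ P? xs

∈-selections⁻ : ∀ {n w} g (a : Fin (suc n) → ℕ) → w ∈ selections g (tabulate a) →
  ∃ λ i → w ∈ g (a i) (tabulate (a ∘ punchIn i))
∈-selections⁻ {n} g a w∈ with ∈-++⁻ (g (a Fin.zero) (tabulate (a ∘ Fin.suc))) w∈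
... | inj₁ w∈₁ = Fin.zero , w∈₁
∈-selections⁻ {suc n} g a w∈ | inj₂ w∈₂ with ∈-selections⁻ (λ y Y → g y (a Fin.zero ∷ Y)) (a ∘ Fin.suc) w∈₂
... | i , w∈g = Fin.suc i , w∈g

∈-selections⁺ : ∀ {n w} g (a : Fin (suc n) → ℕ) i →
  w ∈ g (a i) (tabulate (a ∘ punchIn i)) → w ∈ selections g (tabulate a)
∈-selections⁺ g a Fin.zero w∈ = ∈-++⁺ˡ w∈
∈-selections⁺ {suc n} g a (Fin.suc i) w∈ =
  ∈-++⁺ʳ (g (a Fin.zero) (tabulate (a ∘ Fin.suc)))
    (∈-selections⁺ (λ y Y → g y (a Fin.zero ∷ Y)) (a ∘ Fin.suc) i w∈)

-- The alphabet is a general function a because, once the letter at i has been used, the induction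
-- continues with `a ∘ punchIn i`. The permutation is rebuilt by sending 0 to i.
∈-arrangements⁻ : ∀ n {w} (a : Fin n → ℕ) → w ∈ arrangements n (tabulate a) →
  ∃ λ (σ : Permutation′ n) → tabulate (a ∘ (σ ⟨$⟩ʳ_)) ≡ w
∈-arrangements⁻ zero    a (here refl) = Perm.id , refl
∈-arrangements⁻ (suc n) a w∈ with ∈-selections⁻ (λ x Y → map (x ∷_) (arrangements n Y)) a w∈
... | i , w∈ᵢ with ∈-map⁻ (a i ∷_) w∈ᵢ
... | v , v∈ , refl with ∈-arrangements⁻ n (a ∘ punchIn i) v∈
... | σ , refl = insert Fin.zero i σ ,
  cong (a i ∷_) (tabulate-cong (λ k → cong a (insert-punchIn Fin.zero i σ k)))

∈-arrangements⁺ : ∀ n (a : Fin n → ℕ) (σ : Permutation′ n) →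
  tabulate (a ∘ (σ ⟨$⟩ʳ_)) ∈ arrangements n (tabulate a)
∈-arrangements⁺ zero    a σ = here refl
∈-arrangements⁺ (suc n) a σ = ∈-selections⁺ (λ x Y → map (x ∷_) (arrangements n Y)) a i
  (subst (_∈ map (a i ∷_) (arrangements n (tabulate (a ∘ punchIn i))))
    (cong (a i ∷_) (tabulate-cong (λ k → cong a (sym (punchIn-permute σ Fin.zero k)))))
    (∈-map⁺ (a i ∷_) (∈-arrangements⁺ n (a ∘ punchIn i) (remove Fin.zero σ))))
  where i = σ ⟨$⟩ʳ Fin.zero

-- Blocks for different chosen letters are disjoint because their words start with different
-- letters. The second component carries this fact through the recursion.
selections-unique : ∀ g X → Unique X →
  (∀ {x Y} → Y ⊆ X → Unique (g x Y)) →
  (∀ {x Y w} → w ∈ g x Y → head w ≡ just x) →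
  Unique (selections g X) × (∀ {w} → w ∈ selections g X → ∃ λ x → x ∈ X × head w ≡ just x)
selections-unique g []      _          _ _ = [] , λ ()
selections-unique g (x ∷ X) (x∉ ∷ uX) u h
  with selections-unique (λ y Y → g y (x ∷ Y)) X uX (λ s → u (refl ∷ s)) h
... | uR , hR = Unique.++⁺ (u (x ∷ʳ ⊆-refl)) uR disjoint , heads
  where
  disjoint : ∀ {w} → w ∈ g x X × w ∈ selections (λ y Y → g y (x ∷ Y)) X → ⊥
  disjoint (w∈ , w∈′) with hR w∈′
  ... | y , y∈X , hw = All.lookup x∉ y∈X (just-injective (trans (sym (h w∈)) hw))
  heads : ∀ {w} → w ∈ g x X ++ selections (λ y Y → g y (x ∷ Y)) X → ∃ λ y → y ∈ x ∷ X × head w ≡ just y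
  heads w∈ with ∈-++⁻ (g x X) w∈
  ... | inj₁ w∈₁ = x , here refl , h w∈₁
  ... | inj₂ w∈₂ = let y , y∈X , hw = hR w∈₂ in y , there y∈X , hw

arrangements-unique : ∀ k X → Unique X → Unique (arrangements k X)
arrangements-unique zero    X uX = [] ∷ []
arrangements-unique (suc k) X uX = proj₁ (selections-unique _ X uX
  (λ s → Unique.map⁺ ∷-injectiveʳ (arrangements-unique k _ (AllPairs-⊆ s uX)))
  (λ w∈ → let _ , _ , eq = ∈-map⁻ _ w∈ in cong head eq))

lookup-unique : ∀ {L : List (List ℕ)} → Unique L → ∀ i j → lookup L i ≡ lookup L j → i ≡ j
lookup-unique (_  ∷ _) Fin.zero    Fin.zero    _  = refl
lookup-unique (x∉ ∷ _) Fin.zero    (Fin.suc j) eq = contradiction eq (All.lookup x∉ (∈-lookup j))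
lookup-unique (x∉ ∷ _) (Fin.suc i) Fin.zero    eq = contradiction (sym eq) (All.lookup x∉ (∈-lookup i))
lookup-unique (_  ∷ u) (Fin.suc i) (Fin.suc j) eq = cong Fin.suc (lookup-unique u i j eq)

word-injective : ∀ {n} (σ ρ : Permutation′ n) → word σ ≡ word ρ → ∀ i → σ ⟨$⟩ʳ i ≡ ρ ⟨$⟩ʳ i
word-injective σ ρ eq i = Fin.toℕ-injective (suc-injective (Pointwise.tabulate⁻ (≡⇒Pointwise-≡ eq) i))

word-cong : ∀ {n} (σ ρ : Permutation′ n) → (∀ i → σ ⟨$⟩ʳ i ≡ ρ ⟨$⟩ʳ i) → word σ ≡ word ρ
word-cong σ ρ eq = tabulate-cong (cong (suc ∘ toℕ) ∘ eq)

length-word : ∀ {n} (σ : Permutation′ n) → length (word σ) ≡ n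
length-word σ = length-tabulate (λ i → suc (toℕ (σ ⟨$⟩ʳ i)))

-- From weighted counts to a_{n,S}

Matches : ∀ m q (A B : List ℕ) → List ℕ → Set
Matches m q A B w = All (λ t → st (take m (drop t w)) ≡ q) A × All (λ t → ¬ st (take m (drop t w)) ≡ q) B

matches? : ∀ m q A B → Decidable (Matches m q A B)
matches? m q A B w = all? (λ t → occurs? m q t w) A ×-dec all? (λ t → ¬? (occurs? m q t w)) B

matching : ∀ m q A B n → List (List ℕ)
matching m q A B n = filter (matches? m q A B) (arrangements n (letters n))

length-matching : ∀ m q A B n → length (matching m q A B n) ≡ count m q n A B
length-matching m q A B n = trans (length-filter-χ (matches? m q A B) (arrangements n (letters n)))
  (trans (sum-arrangements _ n (letters n)) (permSum-cong n (λ w _ → χ-weight w) (letters n)))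
  where
  χ-weight : ∀ w → χ (matches? m q A B w) ≡ weight m q A B w
  χ-weight w = sym (trans (cong₂ _*_ (occs-χ m q A w) (nons-χ m q B w))
    (χ-× (all? (λ t → occurs? m q t w) A) (all? (λ t → ¬? (occurs? m q t w)) B) (matches? m q A B w) _,_ id))

-- A and B list, counted from 0, the positions below n that are in S and those
-- that are not.
record Sides (n : ℕ) (S : Pred ℕ 0ℓ) (A B : List ℕ) : Set where
  field
    inside  : ∀ {t} → t ∈ A → S (suc t)
    outside : ∀ {t} → t ∈ B → ¬ S (suc t)
    cover   : ∀ {t} → t < n → t ∈ A ⊎ t ∈ B
    bounded : ∀ {i} → S i → ∃ λ t → i ≡ suc t × t < n

open Sides

module Realize {m} (2≤m : 2 ≤ m) (π : Permutation′ m) (n : ℕ) where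

  Em⁻ : ∀ (σ : Permutation′ n) {i} → Em π σ i →
    ∃ λ t → i ≡ suc t × t < n × st (take m (drop t (word σ))) ≡ word π
  Em⁻ σ {suc t} (_ , l , e) = t , refl , t<n , e
    where
    t<n : t < n
    t<n = s≤s⁻¹ (<-≤-trans (s≤s (m<m+n t (<⇒≤ 2≤m))) (subst (suc t + m ≤_) (+-comm n 1) l))

  -- The range condition follows from the occurrence: only a factor that fits in the word has m
  -- letters.
  Em⁺ : ∀ (σ : Permutation′ n) {t} → st (take m (drop t (word σ))) ≡ word π → Em π σ (suc t)
  Em⁺ σ {t} e = s≤s z≤n , subst (suc t + m ≤_) (+-comm 1 n) (s≤s (subst (t + m ≤_) (length-word σ)
    (occurs-range m (word π) (length-word π) t (word σ) (<⇒≤ 2≤m) e))) , e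

  module _ {S : Pred ℕ 0ℓ} {A B : List ℕ} (sides : Sides n S A B) where

    exactly⇒matches : ∀ σ → Em π σ ≐ S → Matches m (word π) A B (word σ)
    exactly⇒matches σ (Em⊆S , S⊆Em) =
      All.tabulate (λ t∈A → proj₂ (proj₂ (S⊆Em (inside sides t∈A)))) ,
      All.tabulate (λ t∈B o → outside sides t∈B (Em⊆S (Em⁺ σ o)))

    matches⇒exactly : ∀ σ → Matches m (word π) A B (word σ) → Em π σ ≐ S
    matches⇒exactly σ (occ , non) = Em⊆S , S⊆Em
      where
      Em⊆S : ∀ {i} → Em π σ i → S i
      Em⊆S e with Em⁻ σ e
      ... | t , refl , t<n , o =
        Sum.[ inside sides , (λ t∈B → contradiction o (All.lookup non t∈B)) ] (cover sides t<n)
      S⊆Em : ∀ {i} → S i → Em π σ i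
      S⊆Em s with bounded sides s
      ... | t , refl , t<n =
        Sum.[ (λ t∈A → Em⁺ σ (All.lookup occ t∈A))
            , (λ t∈B → contradiction s (outside sides t∈B)) ] (cover sides t<n)

    -- Permutations are enumerated through their words. The list has no repetitions, and equality of
    -- words is pointwise equality of permutations, the equality of `Exactly`.
    countIs : CountIs π n S (count m (word π) n A B)
    countIs = subst (CountIs π n S) (length-matching m (word π) A B n) record
      { to        = proj₁ ∘ realize
      ; from      = index
      ; to-cong   = λ { refl _ → refl }
      ; from-cong = λ {x} {y} x≈y → lookup-unique unique _ _
          (trans (lookup-position x) (trans (word-cong (proj₁ x) (proj₁ y) x≈y) (sym (lookup-position y))))
      ; inverse   =
          (λ { {x} refl → word-injective (proj₁ (proj₁ (realize (index x)))) (proj₁ x)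
                             (trans (proj₂ (realize (index x))) (lookup-position x)) }) ,
          (λ {i} {x} x≈ → lookup-unique unique _ _
            (trans (lookup-position x)
              (trans (word-cong (proj₁ x) (proj₁ (proj₁ (realize i))) x≈) (proj₂ (realize i)))))
      }
      where
      L = matching m (word π) A B n

      unique : Unique L
      unique = Unique.filter⁺ (matches? m (word π) A B)
        (arrangements-unique n (letters n) (AllPairs.map <⇒≢ (letters-increasing n)))

      realize : ∀ i → ∃ λ (x : ∃ λ σ → Em π σ ≐ S) → word (proj₁ x) ≡ lookup L i
      realize i with ∈-filter⁻ (matches? m (word π) A B) {xs = arrangements n (letters n)} (∈-lookup {xs = L} i)
      ... | w∈ , match with ∈-arrangements⁻ n (suc ∘ toℕ) w∈
      ... | σ , eq = (σ , matches⇒exactly σ (subst (Matches m (word π) A B) (sym eq) match)) , eq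

      position : (x : ∃ λ σ → Em π σ ≐ S) → word (proj₁ x) ∈ L
      position (σ , e) = ∈-filter⁺ (matches? m (word π) A B)
        (∈-arrangements⁺ n (suc ∘ toℕ) σ) (exactly⇒matches σ e)

      index : (∃ λ σ → Em π σ ≐ S) → Fin (length L)
      index x = Any.index (position x)

      lookup-position : ∀ x → lookup L (index x) ≡ word (proj₁ x)
      lookup-position x = sym (lookup-index (position x))

  sidesOf : ∀ {S : Pred ℕ 0ℓ} (σ : Permutation′ n) → Em π σ ≐ S → ∃₂ (Sides n S)
  sidesOf σ (Em⊆S , S⊆Em) = filter here? (upTo n) , filter (¬? ∘ here?) (upTo n) , record
    { inside  = λ t∈A → Em⊆S (Em⁺ σ (proj₂ (∈-filter⁻ here? {xs = upTo n} t∈A)))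
    ; outside = λ t∈B s → proj₂ (∈-filter⁻ (¬? ∘ here?) {xs = upTo n} t∈B) (proj₂ (proj₂ (S⊆Em s)))
    ; cover   = cover′
    ; bounded = λ s → let t , eq , t<n , _ = Em⁻ σ (S⊆Em s) in t , eq , t<n
    }
    where
    here? : Decidable (λ t → st (take m (drop t (word σ))) ≡ word π)
    here? t = occurs? m (word π) t (word σ)
    cover′ : ∀ {t} → t < n → t ∈ filter here? (upTo n) ⊎ t ∈ filter (¬? ∘ here?) (upTo n)
    cover′ {t} t<n with here? t
    ... | yes h = inj₁ (∈-filter⁺ here? (∈-upTo⁺ t<n) h)
    ... | no ¬h = inj₂ (∈-filter⁺ (¬? ∘ here?) (∈-upTo⁺ t<n) ¬h)

countIs-unique : ∀ {m} {π : Permutation′ m} {n S k l} → CountIs π n S k → CountIs π n S l → k ≡ l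
countIs-unique a b = ↔⇒≡ (Composition.inverse a (Symmetry.inverse b))

sides-∅ : ∀ n → Sides n ∅ [] (upTo n)
sides-∅ n = record { inside = λ () ; outside = λ _ () ; cover = λ t<n → inj₂ (∈-upTo⁺ t<n) ; bounded = λ () }

-- Non-overlapping patterns and the conclusion

-- For m ≤ 1 the number `m ∸ 1` is 0, but overlaps are at least 1.
nonOverlapping⇒2≤m : ∀ {m} (π : Permutation′ m) → NonOverlapping π → 2 ≤ m
nonOverlapping⇒2≤m {zero}        π (_ , s) with () ← proj₁ (s refl)
nonOverlapping⇒2≤m {suc zero}    π (_ , s) with () ← proj₁ (s refl)
nonOverlapping⇒2≤m {suc (suc m)} π _       = s≤s (s≤s z≤n)

-- Let the occurrences start at s and s + d. The m - d letters they share are a suffix of the first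
-- and a prefix of the second, so standardizing them in two ways shows that d is an overlap of π
-- with d < m - 1.
nonOverlapping⇒separated : ∀ {m} (π : Permutation′ m) → NonOverlapping π → Separated m (word π)
nonOverlapping⇒separated {m} π (only , _) {s} w s<t close os ot with m≤n⇒∃[o]m+o≡n (<⇒≤ s<t)
... | d , refl = contradiction (sym (only {d} (0<d , <⇒≤ d<m∸1 , selfOverlap))) (<⇒≢ d<m∸1)
  where
  open ≡-Reasoning
  0<d : 0 < d
  0<d = +-cancelˡ-< s 0 d (subst (_< s + d) (sym (+-identityʳ s)) s<t)
  1+d<m : suc d < m
  1+d<m = +-cancelˡ-< s (suc d) m (subst (_< s + m) (sym (+-suc s d)) close)
  d<m∸1 : d < m ∸ 1
  d<m∸1 = m+n≤o⇒m≤o∸n (suc d) (subst (_≤ m) (+-comm 1 (suc d)) 1+d<m)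
  d≤m : d ≤ m
  d≤m = <⇒≤ (<⇒≤ 1+d<m)
  u = drop s w
  selfOverlap : st (drop d (word π)) ≡ st (take (m ∸ d) (word π))
  selfOverlap = begin
    st (drop d (word π))                        ≡⟨ cong (st ∘ drop d) os ⟨
    st (drop d (st (take m u)))                 ≡⟨ st-drop d (take m u) ⟩
    st (drop d (take m u))                      ≡⟨ cong (λ k → st (drop d (take k u))) (m+[n∸m]≡n d≤m) ⟨
    st (drop d (take (d + (m ∸ d)) u))          ≡⟨ cong st (take-drop (m ∸ d) d u) ⟨
    st (take (m ∸ d) (drop d u))                ≡⟨ cong (st ∘ take (m ∸ d)) (drop-drop s d w) ⟩
    st (take (m ∸ d) (drop (s + d) w))
      ≡⟨ cong (λ k → st (take k (drop (s + d) w))) (m≤n⇒m⊓n≡m (m∸n≤m m d)) ⟨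
    st (take ((m ∸ d) ⊓ m) (drop (s + d) w))    ≡⟨ cong st (take-take (m ∸ d) m (drop (s + d) w)) ⟨
    st (take (m ∸ d) (take m (drop (s + d) w))) ≡⟨ st-take (m ∸ d) _ ⟨
    st (take (m ∸ d) (st (take m (drop (s + d) w)))) ≡⟨ cong (st ∘ take (m ∸ d)) ot ⟩
    st (take (m ∸ d) (word π))                  ∎

module Transfer {m} (π τ : Permutation′ m) (nπ : NonOverlapping π) (nτ : NonOverlapping τ)
                (equivalent : CWilfEquivalent π τ) where

  2≤m = nonOverlapping⇒2≤m π nπ

  module Rπ = Realize 2≤m π
  module Rτ = Realize 2≤m τ

  -- The hypothesis transfers a relation; uniqueness of sizes turns it into an equation between
  -- numbers.
  avoid : ∀ n → count m (word π) n [] (upTo n) ≡ count m (word τ) n [] (upTo n)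
  avoid n = countIs-unique {π = τ}
    (Equivalence.to (equivalent n _) (Rπ.countIs n (sides-∅ n))) (Rτ.countIs n (sides-∅ n))

  open FixedLength m 2≤m
  open Pair (word π) (word τ) (length-word π) (length-word τ)
           (nonOverlapping⇒separated π nπ) (nonOverlapping⇒separated τ nτ) avoid

  transferSides : ∀ {n S A B k} → Sides n S A B → CountIs π n S k → CountIs τ n S k
  transferSides {n} {S} {A} {B} sides c = subst (CountIs τ n S)
    (trans (sym (counts-agree n A B)) (countIs-unique {π = π} (Rπ.countIs n sides) c)) (Rτ.countIs n sides)

  -- A permutation σ with Em(π,σ) = S or Em(τ,σ) = S decides S; without one, both
  -- counts are 0.
  transfer : ∀ n S k → CountIs π n S k → CountIs τ n S k
  transfer n S (suc k) c = let σ , e = Inverse.to c Fin.zero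
                               _ , _ , sides = Rπ.sidesOf n σ e in transferSides sides c
  transfer n S zero    c = record
    { to        = λ ()
    ; from      = empty
    ; to-cong   = λ { {()} }
    ; from-cong = λ {x} _ → contradiction (empty x) λ ()
    ; inverse   = (λ {x} _ → contradiction (empty x) λ ()) , (λ { {()} })
    }
    where
    empty : (∃ λ σ → Em τ σ ≐ S) → Fin 0
    empty x@(σ , e) = let _ , _ , sides = Rτ.sidesOf n σ e in Inverse.from (transferSides sides c) x

theorem5p4 : (m : ℕ) (π τ : Permutation′ m) →
    NonOverlapping π → NonOverlapping τ →
    CWilfEquivalent π τ → SuperStronglyCWilfEquivalent π τ
theorem5p4 m π τ nπ nτ equivalent n S _ k = mk⇔
  (Transfer.transfer π τ nπ nτ equivalent n S k)
  (Transfer.transfer τ π nτ nπ (λ n k → Symmetry.equivalence (equivalent n k)) n S k)
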